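{- Let $w$ and $w'$ be two Dyck paths in $\mathscr{D}_n$ such that $w$ is smaller than (or equal to) $w'$ in the comb partial order. Then $w\leq w'$ in the dexter order.
   Context: A Dyck path of size $n\geq 0$ is a word of length $2n$ in the letters $0,1$ with $n$ letters $1$ and $n$ letters $0$ such that every prefix contains at least as many $1$'s as $0$'s (the height after a prefix is its number of $1$'s minus its number of $0$'s). Let $\mathscr{D}_n$ be the set of Dyck paths of size $n$. A subpath of a Dyck path $w$ is a non-empty sequence $x$ of consecutive letters of $w$ that starts and ends at the same height and stays strictly above that height in between. A subpath $x$ is movable in $w$ if it is immediately preceded in $w$ by the letter $0$ and either $x$ ends at the last letter of $w$ or $x$ is immediately followed in $w$ by the letter $1$. For a movable subpath $x$, let $N=N(w,x)\geq 1$ be the number of consecutive letters $0$ just before $x$, so $w=a\,0^{N}\,x\,b$ where $a$ does not end with $0$; for $1\leq i\leq N$ let $M(w,x,i)=a\,0^{N-i}\,x\,0^{i}\,b\in\mathscr{D}_n$. Let $\Gamma_n$ be the directed graph on $\mathscr{D}_n$ with edges $w\to M(w,x,i)$ for all movable $x$ in $w$ and all $1\leq i\leq N(w,x)$. The dexter order is: $u\leq v$ if and only if there is a directed path (possibly of length $0$) from $u$ to $v$ in $\Gamma_n$. This is a partial order whose cover relations are exactly the edges of $\Gamma_n$. The comb partial order (of Pallo) on $\mathscr{D}_n$ is the reflexive-transitive closure of the moves $a\,0\,x\,b\to a\,x\,0\,b$, where $x$ is a subpath of the Dyck path $a\,0\,x\,b$ (immediately preceded by a letter $0$) that starts and ends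 at height $0$. -}

module Defs where

open import Data.Fin using (Fin; zero; suc; _≟_)
open import Data.Integer using (ℤ; 0ℤ; _⊖_; _<_)
open import Data.List using (List; []; _∷_; _++_; _∷ʳ_; filter; length; replicate)
open import Data.Nat using (ℕ; _*_; _∸_; _≤_)
open import Data.Product using (_×_; ∃-syntax)
open import Data.Sum using (_⊎_)
open import Relation.Binary using (Rel)
open import Relation.Binary.Construct.Closure.ReflexiveTransitive using (Star)
open import Relation.Binary.PropositionalEquality using (_≡_; _≢_)
open import Level using (0ℓ)

Letter : Set
Letter = Fin 2

pattern 𝟘 = zero
pattern 𝟙 = suc zero

Word : Set
Word = List Letter

occ : Letter → Word → ℕ
occ c p = length (filter (_≟ c) p)

height : Word → ℤ
height p = occ 𝟙 p ⊖ occ 𝟘 p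

-- The conditions on the word are irrelevant fields, so that two Dyck paths
-- with the same word are equal.
record DyckPath (n : ℕ) : Set where
  constructor mkDyck
  field
    word      : Word
    .length≡  : length word ≡ 2 * n
    .ones≡    : occ 𝟙 word ≡ n
    .zeros≡   : occ 𝟘 word ≡ n
    .prefixes : ∀ p s → word ≡ p ++ s → occ 𝟘 p ≤ occ 𝟙 p

open DyckPath public using (word)

-- A subpath is an occurrence of a factor: two occurrences of the same
-- letters at different positions of w are different subpaths.
record Subpath {n : ℕ} (w : DyckPath n) : Set where
  field
    before body after : Word
    factors    : word w ≡ before ++ body ++ after
    nonEmpty   : body ≢ []
    sameHeight : height (before ++ body) ≡ height before
    above      : ∀ y z → body ≡ y ++ z → y ≢ [] → z ≢ [] →
                 height before < height (before ++ y)

record Movable {n : ℕ} {w : DyckPath n} (x : Subpath w) : Set where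
  open Subpath x
  field
    preceded : ∃[ c ] before ≡ c ∷ʳ 𝟘
    followed : after ≡ [] ⊎ ∃[ d ] after ≡ 𝟙 ∷ d

-- The edge w → M(w,x,i). The fields before≡ and maximal determine a and N,
-- so that N is the number N(w,x) of consecutive letters 0 just before x.
record DexterEdge {n : ℕ} (w v : DyckPath n) : Set where
  field
    x       : Subpath w
    movable : Movable x
  open Subpath x
  field
    a       : Word
    N       : ℕ
    before≡ : before ≡ a ++ replicate N 𝟘
    maximal : ∀ c → a ≢ c ∷ʳ 𝟘
    i       : ℕ
    1≤i     : 1 ≤ i
    i≤N     : i ≤ N
    target  : word v ≡ a ++ replicate (N ∸ i) 𝟘 ++ body ++ replicate i 𝟘 ++ after

infix 4 _≤dexter_ _≤comb_

_≤dexter_ : {n : ℕ} → Rel (DyckPath n) 0ℓ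
_≤dexter_ = Star DexterEdge

record CombMove {n : ℕ} (w v : DyckPath n) : Set where
  field
    x       : Subpath w
  open Subpath x
  field
    height0 : height before ≡ 0ℤ
    a       : Word
    before≡ : before ≡ a ∷ʳ 𝟘
    target  : word v ≡ a ++ body ++ 𝟘 ∷ after

_≤comb_ : {n : ℕ} → Rel (DyckPath n) 0ℓ
_≤comb_ = Star CombMove

-- A comb move is a dexter edge with i = 1: since its subpath ends at height 0,
-- the next letter cannot be 0, and so the subpath is movable.

module Submission where

open import Data.Empty using (⊥-elim-irr)
open import Data.Fin using (_≟_)
open import Data.Integer using (0ℤ)
open import Data.Integer.Properties using (+-injective; i-j≡0⇒i≡j; m-n≡m⊖n)
open import Data.List using ([]; _∷_; _++_; _∷ʳ_; filter; length; replicate)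
open import Data.List.Properties
  using (++-assoc; ++-identityʳ; filter-++; length-++; ∷ʳ-++; ∷ʳ-injectiveʳ)
open import Data.List.Reverse using (Reverse; reverseView; []; _∶_∶ʳ_)
open import Data.Nat using (ℕ; zero; suc; _+_; _≤_; z≤n; s≤s)
open import Data.Nat.Properties using (+-comm; +-identityʳ; 1+n≰n)
open import Data.Product using (_×_; _,_; ∃-syntax)
open import Data.Sum using (_⊎_; inj₁; inj₂)
open import Relation.Binary.Construct.Closure.ReflexiveTransitive as Star using ()
open import Relation.Binary.PropositionalEquality
  using (_≡_; _≢_; refl; sym; trans; cong)
open import Relation.Nullary using (¬_)
open import Defs

-- Both orders are reflexive-transitive closures, so it suffices to turn each comb move into a
-- single dexter edge. The subpath of a comb move starts, hence ends, at height 0; a letter 0 right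
-- after it would bring a prefix of the Dyck path to height -1 (`height≡0⇒followed`). So the subpath
-- is movable, and passing one 0 across it is the shift with `i = 1`. An edge also records the whole
-- block of zeros before the subpath, which `splitTrailing𝟘` isolates.

replicate-∷ʳ : ∀ {A : Set} n (x : A) → replicate n x ∷ʳ x ≡ replicate (suc n) x
replicate-∷ʳ zero    x = refl
replicate-∷ʳ (suc n) x = cong (x ∷_) (replicate-∷ʳ n x)

++-replicate-∷ʳ : ∀ {A : Set} xs n (x : A) →
                  (xs ++ replicate n x) ∷ʳ x ≡ xs ++ replicate (suc n) x
++-replicate-∷ʳ xs n x =
  trans (++-assoc xs (replicate n x) _) (cong (xs ++_) (replicate-∷ʳ n x))

-- Zeros are peeled off the right end until a 1 or the empty word is reached, so the recursion
-- follows the snoc view of `p`.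
splitTrailing𝟘 : ∀ (p : Word) → ∃[ a ] ∃[ N ] p ≡ a ++ replicate N 𝟘 × (∀ c → a ≢ c ∷ʳ 𝟘)
splitTrailing𝟘 p = go (reverseView p)
  where
  go : ∀ {p : Word} → Reverse p → ∃[ a ] ∃[ N ] p ≡ a ++ replicate N 𝟘 × (∀ c → a ≢ c ∷ʳ 𝟘)
  go []            = [] , 0 , refl , λ { [] () ; (_ ∷ _) () }
  go (p ∶ _ ∶ʳ 𝟙) = p ∷ʳ 𝟙 , 0 , sym (++-identityʳ _) , maximal
    where
    maximal : ∀ c → p ∷ʳ 𝟙 ≢ c ∷ʳ 𝟘
    maximal c eq with () ← ∷ʳ-injectiveʳ p c eq
  go (_ ∶ r ∶ʳ 𝟘) with go r
  ... | a , N , p≡ , maximal =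
    a , suc N , trans (cong (_∷ʳ 𝟘) p≡) (++-replicate-∷ʳ a N 𝟘) , maximal

occ-++ : ∀ c p q → occ c (p ++ q) ≡ occ c p + occ c q
occ-++ c p q = trans (cong length (filter-++ (_≟ c) p q)) (length-++ (filter (_≟ c) p))

height≡0⇒occ≡ : ∀ p → height p ≡ 0ℤ → occ 𝟙 p ≡ occ 𝟘 p
height≡0⇒occ≡ p h = +-injective (i-j≡0⇒i≡j _ _ (trans (m-n≡m⊖n (occ 𝟙 p) (occ 𝟘 p)) h))

-- Both letters occur equally often in `p`, say `k` times, so the inequality would read `1 + k ≤ k`.
height≡0⇒∷ʳ𝟘-negative : ∀ p → height p ≡ 0ℤ → ¬ (occ 𝟘 (p ∷ʳ 𝟘) ≤ occ 𝟙 (p ∷ʳ 𝟘))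
height≡0⇒∷ʳ𝟘-negative p h le
  rewrite occ-++ 𝟘 p (𝟘 ∷ []) | occ-++ 𝟙 p (𝟘 ∷ []) | height≡0⇒occ≡ p h
        | +-identityʳ (occ 𝟘 p) | +-comm (occ 𝟘 p) 1 = 1+n≰n le

height≡0⇒followed : ∀ {n} (w : DyckPath n) p s → word w ≡ p ++ s → height p ≡ 0ℤ →
                    s ≡ [] ⊎ ∃[ d ] s ≡ 𝟙 ∷ d
height≡0⇒followed _ p []      _ _ = inj₁ refl
height≡0⇒followed _ p (𝟙 ∷ d) _ _ = inj₂ (d , refl)
-- `prefixes` is an irrelevant field, so it may only feed an irrelevant contradiction.
height≡0⇒followed (mkDyck _ _ _ _ prefixes) p (𝟘 ∷ d) eq h = ⊥-elim-irr
  (height≡0⇒∷ʳ𝟘-negative p h (prefixes (p ∷ʳ 𝟘) d (trans eq (sym (∷ʳ-++ p 𝟘 d)))))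

combMove⇒dexterEdge : ∀ {n} {w v : DyckPath n} → CombMove w v → DexterEdge w v
combMove⇒dexterEdge {w = w} m with splitTrailing𝟘 (CombMove.a m)
... | a , N , a≡ , maximal = record
  { x       = x
  ; movable = record
    { preceded = CombMove.a m , before≡
    ; followed = height≡0⇒followed w (before ++ body) after
        (trans factors (sym (++-assoc before body after))) (trans sameHeight height0)
    }
  ; a       = a
  -- The split was applied to the word before the 0 that the move shifts; `suc` counts that 0 as
  -- well.
  ; N       = suc N
  ; before≡ = trans before≡ (trans (cong (_∷ʳ 𝟘) a≡) (++-replicate-∷ʳ a N 𝟘))
  ; maximal = maximal
  ; i       = 1
  ; 1≤i     = s≤s z≤n
  ; i≤N     = s≤s z≤n
  -- `suc N ∸ 1` and `replicate 1 𝟘 ++ after` compute to `N` and `𝟘 ∷ after`, so only reassociation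
  -- remains after rewriting by `a≡`.
  ; target  = trans target (trans (cong (_++ body ++ 𝟘 ∷ after) a≡)
      (++-assoc a (replicate N 𝟘) _))
  }
  where
  open CombMove m using (x; height0; before≡; target)
  open Subpath x

proposition1p7 : (n : ℕ) (w w′ : DyckPath n) → w ≤comb w′ → w ≤dexter w′
proposition1p7 n w w′ = Star.map combMove⇒dexterEdge
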